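{- For every finite simple connected graph $G$ it holds that $\gamma_{cg}'(G) \leq 2\,\gamma_{cg}(G)$.
   Context: The connected domination game on a graph $G$ is played by two players, Dominator and Staller, who alternately select vertices. A vertex $w$ is a legal move if (a) its closed neighborhood $N[w]$ contains at least one vertex not in the union of the closed neighborhoods of the previously selected vertices (i.e. it dominates a new vertex), and (b) unless it is the first move, $w$ is adjacent to at least one already selected vertex. The game ends when no legal move exists; on a connected graph the selected vertices then form a connected dominating set. Dominator wants to minimize the total number of moves, Staller wants to maximize it. $\gamma_{cg}(G)$ is the number of moves under optimal play when Dominator moves first (D-game), and $\gamma_{cg}'(G)$ is the number of moves under optimal play when Staller moves first (S-game). -}

module Defs where

open import Data.Fin.Base using (Fin)
open import Data.Fin.Properties using (any?; _≟_)
open import Data.Fin.Subset using (Subset; _∈_; _⊃_; _∪_; ⁅_⁆; ⊥; Empty)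
open import Data.Fin.Subset.Induction using (⊃-wellFounded)
open import Data.Fin.Subset.Properties using (_∈?_; nonempty?; p⊆p∪q; q⊆p∪q; x∈⁅x⁆)
open import Data.List.Base using (List; []; _∷_; allFin; map; mapMaybe)
open import Data.List.Extrema.Nat using (min; max)
open import Data.Maybe.Base as Maybe using ()
open import Data.Nat.Base using (ℕ; suc)
open import Data.Product.Base using (_×_; _,_; ∃-syntax)
open import Data.Sum.Base using (_⊎_)
open import Induction.WellFounded using (Acc; acc)
open import Level using (0ℓ)
open import Relation.Binary.Construct.Closure.ReflexiveTransitive using (Star)
open import Relation.Binary.Core using (Rel)
open import Relation.Binary.Definitions using (Decidable; Irreflexive; Symmetric)
open import Relation.Binary.PropositionalEquality.Core using (_≡_)
open import Relation.Nullary.Decidable.Core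
  using (Dec; ¬?; _×-dec_; _⊎-dec_; dec⇒maybe)
open import Relation.Nullary.Negation.Core using (¬_)

record Graph : Set₁ where
  field
    order    : ℕ
    _~_      : Rel (Fin order) 0ℓ
    _~?_     : Decidable _~_
    ~-sym    : Symmetric _~_
    ~-irrefl : Irreflexive _≡_ _~_

  Vertex : Set
  Vertex = Fin order

Connected : Graph → Set
Connected G = ∀ u v → Star _~_ u v
  where open Graph G

data Player : Set where
  Dominator Staller : Player

opponent : Player → Player
opponent Dominator = Staller
opponent Staller   = Dominator

-- The argument lists, for each legal move, how many further moves are
-- played after it; the result also counts the move itself.  With no legal
-- move the game is over.
optimal : Player → List ℕ → ℕ
optimal _         []       = 0
optimal Dominator (k ∷ ks) = suc (min k ks)
optimal Staller   (k ∷ ks) = suc (max k ks)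

-- A position is the set S of vertices selected so far.
module Game (G : Graph) where
  open Graph G

  _∈N[_] : Vertex → Vertex → Set
  v ∈N[ w ] = v ≡ w ⊎ v ~ w

  _∈N[_]? : ∀ v w → Dec (v ∈N[ w ])
  v ∈N[ w ]? = (v ≟ w) ⊎-dec (v ~? w)

  DominatedBy : Subset order → Vertex → Set
  DominatedBy S v = ∃[ s ] s ∈ S × v ∈N[ s ]

  dominatedBy? : ∀ S v → Dec (DominatedBy S v)
  dominatedBy? S v = any? λ s → (s ∈? S) ×-dec (v ∈N[ s ]?)

  Legal : Subset order → Vertex → Set
  Legal S w = (∃[ v ] v ∈N[ w ] × ¬ DominatedBy S v)
            × (Empty S ⊎ (∃[ s ] s ∈ S × w ~ s))

  legal? : ∀ S w → Dec (Legal S w)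
  legal? S w =
    any? (λ v → (v ∈N[ w ]?) ×-dec ¬? (dominatedBy? S v))
    ×-dec (¬? (nonempty? S) ⊎-dec any? (λ s → (s ∈? S) ×-dec (w ~? s)))

  legalMoves : ∀ S → List (∃[ w ] Legal S w)
  legalMoves S = mapMaybe (λ w → Maybe.map (w ,_) (dec⇒maybe (legal? S w))) (allFin order)

  legal⇒⊃ : ∀ {S w} → Legal S w → (S ∪ ⁅ w ⁆) ⊃ S
  legal⇒⊃ {S} {w} ((v , v∈N[w] , v∉N[S]) , _) =
    p⊆p∪q ⁅ w ⁆ , w , q⊆p∪q S ⁅ w ⁆ (x∈⁅x⁆ w) , λ w∈S → v∉N[S] (w , w∈S , v∈N[w])

  -- The accessibility argument only ensures termination: a legal move
  -- strictly enlarges S.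
  movesFrom : Player → ∀ S → Acc _⊃_ S → ℕ
  movesFrom p S (acc rs) = optimal p (map
    (λ (w , legal) → movesFrom (opponent p) (S ∪ ⁅ w ⁆) (rs (legal⇒⊃ legal)))
    (legalMoves S))

  moves : Player → Subset order → ℕ
  moves p S = movesFrom p S (⊃-wellFounded S)

γcg : Graph → ℕ
γcg G = Game.moves G Dominator ⊥

γcg′ : Graph → ℕ
γcg′ G = Game.moves G Staller ⊥

{-# OPTIONS --safe #-}

-- Let T be the set of vertices selected in an optimal D-game; it is a
-- connected dominating set with γcg vertices.  In the S-game Dominator only
-- plays vertices of T.  He always can: if no vertex of T is legal, then the
-- vertices of T dominated so far are closed under adjacency in T, so by
-- connectedness they are all of T and have no undominated neighbour, i.e. the
-- game is over.  Hence Dominator makes at most |T| moves, and once he has made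
-- |T| of them Staller has no reply; as Staller starts, the game lasts at most
-- 2 |T| moves.
module Submission where

open import Defs
open import Data.Nat.Base using (_≤_; _*_)
open import Data.Bool.Base using (true; false)
open import Data.Fin.Properties using (any?)
open import Data.Fin.Subset
  using (Subset; _∈_; _∉_; _⊃_; _∪_; _─_; ⁅_⁆; ⊥; ⊤; Empty; Nonempty; ∣_∣)
open import Data.Fin.Subset.Induction using (⊃-wellFounded)
open import Data.Fin.Subset.Properties
  using (_∈?_; nonempty?; ∈⊤; ∉⊥; ∣⊥∣≡0; ∣⁅x⁆∣≡1; ∣p─q∣≤∣p∣; p⊆p∪q; q⊆p∪q; x∈⁅x⁆; x∈⁅y⁆⇒x≡y;
         x∈p⇒∣p-x∣<∣p∣; x∈p∧x∉q⇒x∈p─q; x∈p∪q⁻; p─q─r≡p─q∪r)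
open import Data.List.Base using ([]; _∷_; map)
open import Data.List.Extrema.Nat using (argmin-sel; argmax-sel; max<v⁺; min<v⁺)
open import Data.List.Membership.Propositional using () renaming (_∈_ to _∈ₗ_)
open import Data.List.Membership.Propositional.Properties using (∈-map⁻; ∈-allFin)
open import Data.List.Relation.Unary.All as All using (All; []; _∷_)
open import Data.List.Relation.Unary.All.Properties using () renaming (map⁺ to All-map⁺)
open import Data.List.Relation.Unary.Any as Any using (Any; here; there)
open import Data.List.Relation.Unary.Any.Properties using (mapMaybe⁺) renaming (map⁺ to Any-map⁺)
open import Data.Maybe.Base as Maybe using ()
open import Data.Maybe.Relation.Unary.Any as MAny using (just)
open import Data.Nat.Base using (ℕ; zero; suc; pred; _+_; _<_; z≤n; s≤s)
open import Data.Nat.Properties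
  using (≤-trans; ≤-reflexive; ≤-<-trans; <-≤-trans; n<1+n; n≤1+n; m≤m+n; m<n⇒0<n; +-comm; +-suc;
         +-monoˡ-≤; +-monoʳ-≤; *-monoʳ-≤; module ≤-Reasoning)
open import Data.Product.Base using (_×_; _,_; ∃-syntax; proj₁)
open import Data.Sum.Base using (_⊎_; inj₁; inj₂)
open import Data.Vec.Base using ([]; _∷_)
open import Function.Base using (id)
open import Induction.WellFounded using (Acc; acc)
open import Relation.Binary.Construct.Closure.ReflexiveTransitive using (Star; ε; _◅_)
open import Relation.Binary.PropositionalEquality.Core
  using (_≡_; refl; sym; cong; subst)
open import Relation.Nullary.Decidable.Core
  using (Dec; yes; no; _×-dec_; decidable-stable; dec⇒maybe)
open import Relation.Nullary.Negation.Core using (¬_; contradiction)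

∣p∪q∣≤∣p∣+∣q∣ : ∀ {n} (p q : Subset n) → ∣ p ∪ q ∣ ≤ ∣ p ∣ + ∣ q ∣
∣p∪q∣≤∣p∣+∣q∣ []          []          = z≤n
∣p∪q∣≤∣p∣+∣q∣ (false ∷ p) (false ∷ q) = ∣p∪q∣≤∣p∣+∣q∣ p q
∣p∪q∣≤∣p∣+∣q∣ (false ∷ p) (true  ∷ q) =
  ≤-trans (s≤s (∣p∪q∣≤∣p∣+∣q∣ p q)) (≤-reflexive (sym (+-suc ∣ p ∣ ∣ q ∣)))
∣p∪q∣≤∣p∣+∣q∣ (true  ∷ p) (false ∷ q) = s≤s (∣p∪q∣≤∣p∣+∣q∣ p q)
∣p∪q∣≤∣p∣+∣q∣ (true  ∷ p) (true  ∷ q) =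
  s≤s (≤-trans (∣p∪q∣≤∣p∣+∣q∣ p q) (+-monoʳ-≤ ∣ p ∣ (n≤1+n ∣ q ∣)))

∣p∪⁅x⁆∣≤1+∣p∣ : ∀ {n} (p : Subset n) x → ∣ p ∪ ⁅ x ⁆ ∣ ≤ suc ∣ p ∣
∣p∪⁅x⁆∣≤1+∣p∣ p x = begin
  ∣ p ∪ ⁅ x ⁆ ∣      ≤⟨ ∣p∪q∣≤∣p∣+∣q∣ p ⁅ x ⁆ ⟩
  ∣ p ∣ + ∣ ⁅ x ⁆ ∣  ≡⟨ cong (∣ p ∣ +_) (∣⁅x⁆∣≡1 x) ⟩
  ∣ p ∣ + 1          ≡⟨ +-comm ∣ p ∣ 1 ⟩
  suc ∣ p ∣          ∎
  where open ≤-Reasoning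

∣p─q∪r∣≤∣p─q∣ : ∀ {n} (p q r : Subset n) → ∣ p ─ (q ∪ r) ∣ ≤ ∣ p ─ q ∣
∣p─q∪r∣≤∣p─q∣ p q r =
  subst (λ s → ∣ s ∣ ≤ ∣ p ─ q ∣) (p─q─r≡p─q∪r p q r) (∣p─q∣≤∣p∣ (p ─ q) r)

x∈p∧x∉q⇒∣p─q∪⁅x⁆∣<∣p─q∣ : ∀ {n} {p q : Subset n} {x} → x ∈ p → x ∉ q →
                          ∣ p ─ (q ∪ ⁅ x ⁆) ∣ < ∣ p ─ q ∣
x∈p∧x∉q⇒∣p─q∪⁅x⁆∣<∣p─q∣ {p = p} {q} {x} x∈p x∉q =
  subst (λ s → ∣ s ∣ < ∣ p ─ q ∣) (p─q─r≡p─q∪r p q ⁅ x ⁆)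
        (x∈p⇒∣p-x∣<∣p∣ (x∈p∧x∉q⇒x∈p─q x∈p x∉q))

map≡[]⇒≡[] : ∀ {A B : Set} {f : A → B} {xs} → map f xs ≡ [] → xs ≡ []
map≡[]⇒≡[] {xs = []} _ = refl

-- Lets one follow a line of optimal play: whoever is to move, the extremum is attained at some
-- entry, so some move realises the value.
optimal-sel : ∀ p ks → ks ≡ [] ⊎ ∃[ k ] k ∈ₗ ks × optimal p ks ≡ suc k
optimal-sel _         []       = inj₁ refl
optimal-sel Dominator (k ∷ ks) with argmin-sel id k ks
... | inj₁ min≡k  = inj₂ (k , here refl , cong suc min≡k)
... | inj₂ min∈ks = inj₂ (_ , there min∈ks , refl)
optimal-sel Staller   (k ∷ ks) with argmax-sel id k ks
... | inj₁ max≡k  = inj₂ (k , here refl , cong suc max≡k)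
... | inj₂ max∈ks = inj₂ (_ , there max∈ks , refl)

-- One good move bounds a minimum, while a maximum needs all moves bounded. The strict `_< n` leaves
-- room for the move itself.
optimal-Dominator-≤ : ∀ {ks n} → Any (_< n) ks → optimal Dominator ks ≤ n
optimal-Dominator-≤ {k ∷ ks} (here k<n)   = min<v⁺ k ks (inj₁ k<n)
optimal-Dominator-≤ {k ∷ ks} (there ks<n) = min<v⁺ k ks (inj₂ ks<n)

optimal-Staller-≤ : ∀ {ks n} → All (_< n) ks → optimal Staller ks ≤ n
optimal-Staller-≤ []           = z≤n
optimal-Staller-≤ (k<n ∷ ks<n) = max<v⁺ k<n ks<n

optimal-map-[] : ∀ {A : Set} p (f : A → ℕ) {xs} → xs ≡ [] → optimal p (map f xs) ≡ 0
optimal-map-[] _ _ refl = refl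

module _ (G : Graph) where
  open Graph G
  open Game G

  Dominating : Subset order → Set
  Dominating T = ∀ v → DominatedBy T v

  -- Connectedness of the induced subgraph, as an induction principle.
  ConnectedSet : Subset order → Set₁
  ConnectedSet T = (P : Vertex → Set) →
                   (∀ {u v} → u ∈ T → v ∈ T → u ~ v → P u → P v) →
                   ∀ {u v} → u ∈ T → v ∈ T → P u → P v

  ⊥-connected : ConnectedSet ⊥
  ⊥-connected _ _ u∈⊥ = contradiction u∈⊥ ∉⊥

  ⊤-connected : Connected G → ConnectedSet ⊤
  ⊤-connected conn P step {u} {v} _ _ = along (conn u v)
    where
    along : ∀ {u v} → Star _~_ u v → P u → P v
    along ε          Pu = Pu
    along (u~w ◅ ws) Pu = along ws (step ∈⊤ ∈⊤ u~w Pu)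

  -- Everything passes between `w` and `S` through the selected neighbour `s`; for empty `S` only
  -- the vertex `w` is left.
  ∪-connected : ∀ {S w} → ConnectedSet S → Empty S ⊎ (∃[ s ] s ∈ S × w ~ s) →
                ConnectedSet (S ∪ ⁅ w ⁆)
  ∪-connected {S} {w} conn attached P step u∈ v∈ Pu
    with x∈p∪q⁻ S ⁅ w ⁆ u∈ | x∈p∪q⁻ S ⁅ w ⁆ v∈ | attached
  ... | inj₁ u∈S | inj₁ v∈S | _ =
    conn P (λ x∈S y∈S → step (p⊆p∪q _ x∈S) (p⊆p∪q _ y∈S)) u∈S v∈S Pu
  ... | inj₁ u∈S | inj₂ v∈⁅w⁆ | inj₁ S-empty = contradiction (_ , u∈S) S-empty
  ... | inj₁ u∈S | inj₂ v∈⁅w⁆ | inj₂ (s , s∈S , w~s)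
    with refl ← x∈⁅y⁆⇒x≡y w v∈⁅w⁆ =
    step (p⊆p∪q _ s∈S) v∈ (~-sym w~s)
      (conn P (λ x∈S y∈S → step (p⊆p∪q _ x∈S) (p⊆p∪q _ y∈S)) u∈S s∈S Pu)
  ... | inj₂ u∈⁅w⁆ | inj₁ v∈S | inj₁ S-empty = contradiction (_ , v∈S) S-empty
  ... | inj₂ u∈⁅w⁆ | inj₁ v∈S | inj₂ (s , s∈S , w~s)
    with refl ← x∈⁅y⁆⇒x≡y w u∈⁅w⁆ =
    conn P (λ x∈S y∈S → step (p⊆p∪q _ x∈S) (p⊆p∪q _ y∈S)) s∈S v∈S
      (step u∈ (p⊆p∪q _ s∈S) w~s Pu)
  ... | inj₂ u∈⁅w⁆ | inj₂ v∈⁅w⁆ | _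
    with refl ← x∈⁅y⁆⇒x≡y w u∈⁅w⁆ | refl ← x∈⁅y⁆⇒x≡y w v∈⁅w⁆ = Pu

  legal⇒∉ : ∀ {S w} → Legal S w → w ∉ S
  legal⇒∉ ((_ , v∈N[w] , v-undominated) , _) w∈S = v-undominated (_ , w∈S , v∈N[w])

  -- Only the vertex is matched: the list stores the legality proof found by `legal?`, which may
  -- differ from the given one.
  legal⇒∈legalMoves : ∀ {S w} → Legal S w → Any (λ m → proj₁ m ≡ w) (legalMoves S)
  legal⇒∈legalMoves {S} {w} legal =
    mapMaybe⁺ _ _ (Any-map⁺ (Any.map (λ { refl → found (legal? S w) }) (∈-allFin w)))
    where
    found : (d : Dec (Legal S w)) →
            MAny.Any (λ m → proj₁ m ≡ w) (Maybe.map (w ,_) (dec⇒maybe d))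
    found (yes _)      = just refl
    found (no illegal) = contradiction legal illegal

  illegal⇒legalMoves≡[] : ∀ {S} → (∀ {w} → ¬ Legal S w) → legalMoves S ≡ []
  illegal⇒legalMoves≡[] {S} illegal with legalMoves S
  ... | []              = refl
  ... | (_ , legal) ∷ _ = contradiction legal illegal

  legalMoves≡[]⇒illegal : ∀ {S w} → legalMoves S ≡ [] → ¬ Legal S w
  legalMoves≡[]⇒illegal {S} none legal with legalMoves S | legal⇒∈legalMoves legal
  legalMoves≡[]⇒illegal refl _ | [] | ()

  -- Some `d₀ ∈ T` dominates `s₀` and so is dominated by `S`. By `spread`, domination travels inside
  -- `T` from `d₀` to a neighbour-or-equal `d` of `v`, and then to `v`.
  stuck⇒dominating : ∀ {S T} → ConnectedSet T → Dominating T → Nonempty S →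
                     (∀ {w} → w ∈ T → ¬ Legal S w) → Dominating S
  stuck⇒dominating {S} {T} conn T-dom (s₀ , s₀∈S) illegal v
    with d₀ , d₀∈T , s₀∈N[d₀] ← T-dom s₀ | d , d∈T , v∈N[d] ← T-dom v =
    spread d∈T
      (conn (DominatedBy S) (λ u∈T _ u~w dom → spread u∈T dom (inj₂ (~-sym u~w)))
            d₀∈T d∈T (s₀ , s₀∈S , N-sym s₀∈N[d₀]))
      v∈N[d]
    where
    N-sym : ∀ {x y} → x ∈N[ y ] → y ∈N[ x ]
    N-sym (inj₁ refl) = inj₁ refl
    N-sym (inj₂ x~y)  = inj₂ (~-sym x~y)

    -- Either `u` is selected and dominates `x` itself, or it is adjacent to `S`, and an undominated
    -- `x` would make `u` legal.
    spread : ∀ {u x} → u ∈ T → DominatedBy S u → x ∈N[ u ] → DominatedBy S x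
    spread         _   (s , s∈S , inj₁ refl) x∈N[u] = s , s∈S , x∈N[u]
    spread {x = x} u∈T (s , s∈S , inj₂ u~s)  x∈N[u] =
      decidable-stable (dominatedBy? S x)
        λ x-undominated → illegal u∈T ((x , x∈N[u] , x-undominated) , inj₂ (s , s∈S , u~s))

  gameOver⇒dominating : Connected G → ∀ {S} → (∀ {w} → ¬ Legal S w) → Dominating S
  gameOver⇒dominating conn {S} illegal with nonempty? S
  ... | yes S-nonempty =
    stuck⇒dominating (⊤-connected conn) (λ v → v , ∈⊤ , inj₁ refl) S-nonempty (λ _ → illegal)
  -- Every vertex is a legal first move, so here the graph has no vertices.
  ... | no S-empty = λ v → contradiction
    ((v , inj₁ refl , λ (s , s∈S , _) → S-empty (s , s∈S)) , inj₁ S-empty) illegal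

  -- `T` is the position reached at the end of one optimal line of play; each move adds at most one
  -- vertex and preserves connectedness.
  finalSet : Connected G → ∀ p S (a : Acc _⊃_ S) → ConnectedSet S →
             ∃[ T ] ConnectedSet T × Dominating T × ∣ T ∣ ≤ ∣ S ∣ + movesFrom p S a
  finalSet conn p S (acc rs) S-conn
    with optimal-sel p (map (λ (w , legal) →
           movesFrom (opponent p) (S ∪ ⁅ w ⁆) (rs (legal⇒⊃ legal))) (legalMoves S))
  ... | inj₁ none =
    S , S-conn
      , gameOver⇒dominating conn (legalMoves≡[]⇒illegal (map≡[]⇒≡[] none))
      , m≤m+n ∣ S ∣ _
  ... | inj₂ (k , k∈ , optimal≡1+k)
    with (w , legal@(_ , attached)) , _ , refl ← ∈-map⁻ _ k∈
    with T , T-conn , T-dom , ∣T∣≤ ←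
           finalSet conn (opponent p) (S ∪ ⁅ w ⁆) (rs (legal⇒⊃ legal)) (∪-connected S-conn attached) =
    T , T-conn , T-dom , (begin
      ∣ T ∣                ≤⟨ ∣T∣≤ ⟩
      ∣ S ∪ ⁅ w ⁆ ∣ + k    ≤⟨ +-monoˡ-≤ k (∣p∪⁅x⁆∣≤1+∣p∣ S w) ⟩
      suc ∣ S ∣ + k        ≡⟨ +-suc ∣ S ∣ k ⟨
      ∣ S ∣ + suc k        ≡⟨ cong (∣ S ∣ +_) optimal≡1+k ⟨
      ∣ S ∣ + _            ∎)
    where open ≤-Reasoning

  module _ {T} (T-conn : ConnectedSet T) (T-dom : Dominating T) where

    -- A vertex of `T` dominating the undominated `v` cannot be selected yet. So while Staller has a
    -- move, her bound is positive.
    legal⇒∃∈T─S : ∀ {S w} → Legal S w → ∃[ d ] d ∈ T × d ∉ S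
    legal⇒∃∈T─S ((v , _ , v-undominated) , _) with d , d∈T , v∈N[d] ← T-dom v =
      d , d∈T , λ d∈S → v-undominated (d , d∈S , v∈N[d])

    -- For T ⊆ S the bound is pred 0 = 0: the game is over.
    Dominator-≤ : ∀ S (a : Acc _⊃_ S) → Nonempty S →
                  movesFrom Dominator S a ≤ pred (2 * ∣ T ─ S ∣)
    -- Each vertex of `T ─ S` pays for two moves, one of Staller and one of Dominator; with
    -- Dominator to move, Staller's half of one pair is already spent.
    Staller-≤ : ∀ S (a : Acc _⊃_ S) → movesFrom Staller S a ≤ 2 * ∣ T ─ S ∣

    Dominator-≤ S (acc rs) S-nonempty with any? (λ w → (w ∈? T) ×-dec legal? S w)
    ... | yes (w , w∈T , legal) =
      optimal-Dominator-≤ (Any-map⁺ (Any.map (λ { {_ , legal′} refl →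
        <-≤-trans (s≤s (Staller-≤ (S ∪ ⁅ w ⁆) (rs (legal⇒⊃ legal′))))
                  (2*-pred (x∈p∧x∉q⇒∣p─q∪⁅x⁆∣<∣p─q∣ w∈T (legal⇒∉ legal))) })
        (legal⇒∈legalMoves legal)))
      where
      -- A move in `T` shrinks `T ─ S`, and 2 (n - 1) + 1 = 2 n - 1, where the 1 counts Dominator's
      -- move.
      2*-pred : ∀ {m n} → m < n → 2 * m < pred (2 * n)
      2*-pred {m} {suc n} (s≤s m≤n) = begin-strict
        2 * m              ≤⟨ *-monoʳ-≤ 2 m≤n ⟩
        2 * n              <⟨ n<1+n (2 * n) ⟩
        suc (2 * n)        ≡⟨ +-suc n (n + 0) ⟨
        pred (2 * suc n)   ∎
        where open ≤-Reasoning
    ... | no T-illegal =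
      -- `S` is already dominating, so no vertex at all is legal and the value is 0.
      ≤-trans (≤-reflexive (optimal-map-[] Dominator _
        (illegal⇒legalMoves≡[] λ ((v , _ , v-undominated) , _) →
          v-undominated (stuck⇒dominating T-conn T-dom S-nonempty
            (λ w∈T legal → T-illegal (_ , w∈T , legal)) v))))
        z≤n

    Staller-≤ S (acc rs) = optimal-Staller-≤ (All-map⁺ (All.universal bound (legalMoves S)))
      where
      -- The unit removed by `pred` pays for Staller's move. At `m = 0` nothing is removed, and
      -- `0 < n` pays instead.
      pred-2* : ∀ {m n} → m ≤ n → 0 < n → pred (2 * m) < 2 * n
      pred-2* {zero}  {suc n} _   _ = s≤s z≤n
      pred-2* {suc m} {n}     m<n _ = *-monoʳ-≤ 2 m<n

      bound : ∀ ((w , legal) : ∃[ w ] Legal S w) →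
              movesFrom Dominator (S ∪ ⁅ w ⁆) (rs (legal⇒⊃ legal)) < 2 * ∣ T ─ S ∣
      bound (w , legal) with d , d∈T , d∉S ← legal⇒∃∈T─S legal =
        ≤-<-trans (Dominator-≤ (S ∪ ⁅ w ⁆) (rs (legal⇒⊃ legal)) (w , q⊆p∪q S ⁅ w ⁆ (x∈⁅x⁆ w)))
          -- Staller's vertex may lie inside or outside `T`, so `∣ T ─ S ∣` is only known not to
          -- grow.
          (pred-2* (∣p─q∪r∣≤∣p─q∣ T S ⁅ w ⁆)
                   (m<n⇒0<n (x∈p∧x∉q⇒∣p─q∪⁅x⁆∣<∣p─q∣ d∈T d∉S)))

theorem3p2 : (G : Graph) → Connected G → γcg′ G ≤ 2 * γcg G
theorem3p2 G conn
  with T , T-conn , T-dom , ∣T∣≤ ← finalSet G conn Dominator ⊥ (⊃-wellFounded ⊥) (⊥-connected G) =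
  begin
    γcg′ G                       ≤⟨ Staller-≤ G T-conn T-dom ⊥ (⊃-wellFounded ⊥) ⟩
    2 * ∣ T ─ ⊥ ∣                ≤⟨ *-monoʳ-≤ 2 (∣p─q∣≤∣p∣ T ⊥) ⟩
    2 * ∣ T ∣                    ≤⟨ *-monoʳ-≤ 2 ∣T∣≤ ⟩
    2 * (∣ ⊥ {order} ∣ + γcg G)  ≡⟨ cong (λ n → 2 * (n + γcg G)) (∣⊥∣≡0 order) ⟩
    2 * γcg G                    ∎
  where
  open Graph G
  open ≤-Reasoning
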